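{- Let $G$ be an edge-colored graph on $n$ vertices. If $\sum_{v\in V(G)}d^c(v)\geq n(n+1)/2$, then $G$ contains a rainbow triangle.
   Context: All graphs are simple and finite, with at least one vertex. An edge-colored graph is a graph $G=(V,E)$ together with an arbitrary mapping $C:E\to\mathbb{N}$ (not required to be a proper edge-coloring). For a vertex $v$ of $G$, the color degree $d^c(v)$ is the number of distinct colors appearing on the edges incident to $v$. A rainbow triangle is a triangle of $G$ whose three edges have pairwise distinct colors. -}

module Defs where

open import Algebra.Properties.CommutativeMonoid.Sum using (sum)
open import Data.Fin.Base using (Fin)
open import Data.List.Base using (List; allFin; deduplicate; length; mapMaybe)
open import Data.Maybe.Base as Maybe using ()
open import Data.Nat.Base using (ℕ)
open import Data.Nat.Properties using (_≟_; +-0-commutativeMonoid)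
open import Data.Product.Base using (∃-syntax)
open import Level using (0ℓ)
open import Relation.Binary.Core using (Rel)
open import Relation.Binary.Definitions using (Decidable; Irreflexive; Symmetric)
open import Relation.Binary.PropositionalEquality.Core using (_≡_; _≢_)
open import Relation.Nullary.Decidable using (dec⇒maybe)

record SimpleGraph (n : ℕ) : Set₁ where
  field
    Adj    : Rel (Fin n) 0ℓ
    adj?   : Decidable Adj
    sym    : Symmetric Adj
    irrefl : Irreflexive _≡_ Adj

record EdgeColoredGraph (n : ℕ) : Set₁ where
  field
    graph : SimpleGraph n
  open SimpleGraph graph public
  field
    color     : ∀ {u v} → Adj u v → ℕ
    -- Since p and q are arbitrary, the color depends only on the unordered
    -- pair {u , v}, and not on the chosen proof of adjacency.
    color-sym : ∀ {u v} (p : Adj u v) (q : Adj v u) → color p ≡ color q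

module _ {n : ℕ} (G : EdgeColoredGraph n) where
  open EdgeColoredGraph G

  -- One entry per edge incident to v, so colors may be repeated.
  incidentColors : Fin n → List ℕ
  incidentColors v = mapMaybe (λ u → Maybe.map color (dec⇒maybe (adj? v u))) (allFin n)

  colorDegree : Fin n → ℕ
  colorDegree v = length (deduplicate _≟_ (incidentColors v))

  colorDegreeSum : ℕ
  colorDegreeSum = sum +-0-commutativeMonoid colorDegree

  record RainbowTriangle (u v w : Fin n) : Set where
    field
      uv    : Adj u v
      vw    : Adj v w
      uw    : Adj u w
      uv≢vw : color uv ≢ color vw
      vw≢uw : color vw ≢ color uw
      uv≢uw : color uv ≢ color uw

  HasRainbowTriangle : Set
  HasRainbowTriangle = ∃[ u ] ∃[ v ] ∃[ w ] RainbowTriangle u v w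

{-# OPTIONS --safe #-}
-- Let δ(v) be the loss in the colour degree sum when v is deleted: d^c(v) plus the
-- number s(v) of edges vw whose colour is seen at w on no other edge (call w
-- private to v).  Since n(n+1)/2 − n(n−1)/2 = n, by induction it suffices to
-- find v with δ(v) ≤ n in a graph without rainbow triangles.
-- Let t(v) be the number of colours on the edges from v to its private
-- vertices.  The other edges at v carry at most d(v) − s(v) further colours, so
-- δ(v) ≤ d(v) + t(v).  Two private vertices of v joined to it by different
-- colours are not adjacent, as they would span a rainbow triangle with v.
-- Hence, if t(v) is maximal, a private vertex u of v has at least t(v)
-- non-neighbours (itself included), and δ(u) ≤ d(u) + t(u) ≤ n − t(v) + t(u) ≤ n.
module Submission where

open import Defs
open import Data.Nat.Base using (ℕ; NonZero; _+_; _*_; _≥_)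
open import Data.Nat.DivMod using (_/_)

open import Algebra.Properties.CommutativeMonoid.Sum using () renaming (sum to ∑)
open import Data.Bool.Base using (true; false)
open import Data.Fin.Base using (Fin; zero; suc)
open import Data.Fin.Properties using (any?)
open import Data.List.Base
  using (List; []; _∷_; _++_; length; map; mapMaybe; filter; deduplicate; allFin; tabulate)
open import Data.List.Extrema.Nat using (argmax; argmax-all; f[xs]≤f[argmax])
open import Data.List.Membership.Propositional using (_∈_; _∉_)
open import Data.List.Membership.Propositional.Properties
  using (∈-∃++; ∈-filter⁺; ∈-filter⁻; ∈-deduplicate⁺; ∈-deduplicate⁻; ∈-++⁺ˡ; ∈-++⁺ʳ)
open import Data.List.Membership.DecPropositional using (_∈?_)
open import Data.List.Properties
  using (filter-notAll; filter-some; filter-none; filter-accept; filter-≐;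
         length-++; length-mapMaybe; length-tabulate; map-cong; map-tabulate)
open import Data.List.Relation.Binary.Permutation.Propositional
  using (_↭_; ↭-sym)
open import Data.List.Relation.Binary.Permutation.Propositional.Properties
  using (↭-length; filter-↭; mapMaybe-↭; map⁺; ∈-resp-↭; shift)
open import Data.List.Relation.Binary.Subset.Propositional using (_⊆_)
import Data.List.Relation.Unary.All as All
open import Data.List.Relation.Unary.Any using (here; there)
import Data.List.Relation.Unary.Any as Any
open import Data.List.Relation.Unary.AllPairs using ([]; _∷_)
open import Data.List.Relation.Unary.Unique.Propositional using (Unique)
open import Data.List.Relation.Unary.Unique.DecPropositional.Properties using (deduplicate-!)
open import Data.Maybe.Base using (Maybe; just; nothing)
import Data.Maybe.Base as Maybe
open import Data.Maybe.Properties using (just-injective)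
open import Data.Maybe.Relation.Unary.Any using (just)
import Data.Maybe.Relation.Unary.Any as MaybeAny
open import Data.Nat.Base using (zero; suc; _≤_; z≤n; s≤s; s≤s⁻¹)
open import Data.Nat.DivMod using (/-monoˡ-≤; m*n/n≡m)
open import Data.Nat.ListAction using (sum)
open import Data.Nat.ListAction.Properties using (sum-↭)
open import Data.Nat.Properties
open import Data.Nat.Tactic.RingSolver using (solve-∀)
open import Data.Product.Base using (∃-syntax; _×_; _,_; proj₁; proj₂)
open import Function.Base using (_∘_; id)
open import Level using (0ℓ)
open import Relation.Binary.PropositionalEquality
  using (_≡_; _≢_; refl; sym; trans; cong; cong₂; subst; subst₂)
open import Relation.Nullary using (Dec; yes; no; does; ¬_; ¬?; contradiction; dec⇒maybe)
open import Relation.Nullary.Decidable using (map′; _×-dec_)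
open import Relation.Unary using (Pred; Decidable)

-- Lists under partial maps.

module _ {A : Set} where

  ∈-mapMaybe⁺ : ∀ {B : Set} (f : A → Maybe B) {x y xs} →
                x ∈ xs → f x ≡ just y → y ∈ mapMaybe f xs
  ∈-mapMaybe⁺ f {xs = x ∷ _} (here refl) eq with just _ ← f x | refl ← eq = here refl
  ∈-mapMaybe⁺ f {xs = x ∷ _} (there p) eq with f x
  ... | nothing = ∈-mapMaybe⁺ f p eq
  ... | just _  = there (∈-mapMaybe⁺ f p eq)

  ∈-mapMaybe⁻ : ∀ {B : Set} (f : A → Maybe B) {y} xs →
                y ∈ mapMaybe f xs → ∃[ x ] (x ∈ xs × f x ≡ just y)
  ∈-mapMaybe⁻ f (x ∷ xs) p with f x in eq | p
  ... | nothing | q with z , z∈ , e ← ∈-mapMaybe⁻ f xs q = z , there z∈ , e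
  ... | just _  | here refl = x , here refl , eq
  ... | just _  | there q with z , z∈ , e ← ∈-mapMaybe⁻ f xs q = z , there z∈ , e

  ∈⇒↭∷ : ∀ {x : A} {xs} → x ∈ xs → ∃[ ys ] xs ↭ x ∷ ys
  ∈⇒↭∷ x∈xs with ys , zs , refl ← ∈-∃++ x∈xs = ys ++ zs , shift _ ys zs

  -- `f` is defined wherever `P` holds, so each element kept by the first filter accounts for one
  -- value of its own. With private vertices as `P`, this separates private edges from the others
  -- when counting a degree.
  length-mapMaybe-filter : ∀ {B : Set} {P : Pred A 0ℓ} (P? : Decidable P) (f : A → Maybe B) →
    (∀ {x} → P x → f x ≢ nothing) → ∀ xs →
    length (filter P? xs) + length (mapMaybe f (filter (¬? ∘ P?) xs)) ≤ length (mapMaybe f xs)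
  length-mapMaybe-filter P? f def [] = z≤n
  length-mapMaybe-filter P? f def (x ∷ xs) with ih ← length-mapMaybe-filter P? f def xs | P? x
  ... | yes p with f x | def p
  ...   | nothing | ≢nothing = contradiction refl ≢nothing
  ...   | just _  | _        = s≤s ih
  length-mapMaybe-filter P? f def (x ∷ xs) | no _ with f x
  ...   | nothing = ih
  ...   | just _  = ≤-trans (≤-reflexive (+-suc _ _)) (s≤s ih)

  is-nothing? : ∀ {B : Set} (f : A → Maybe B) → Decidable (λ x → f x ≡ nothing)
  is-nothing? f x with f x
  ... | nothing = yes refl
  ... | just _  = no λ ()

  length-mapMaybe-nothing : ∀ {B : Set} (f : A → Maybe B) xs →
    length (mapMaybe f xs) + length (filter (is-nothing? f) xs) ≤ length xs
  length-mapMaybe-nothing f [] = z≤n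
  length-mapMaybe-nothing f (x ∷ xs) with ih ← length-mapMaybe-nothing f xs | f x
  ... | nothing = ≤-trans (≤-reflexive (+-suc _ _)) (s≤s ih)
  ... | just _  = s≤s ih

  maximizer : (f : A → ℕ) (x : A) (xs : List A) →
              ∃[ y ] (y ∈ x ∷ xs × (∀ {z} → z ∈ x ∷ xs → f z ≤ f y))
  maximizer f x xs =
    argmax f x (x ∷ xs) ,
    argmax-all f (here refl) (All.tabulate id) ,
    All.lookup (f[xs]≤f[argmax] {f = f} x (x ∷ xs))

-- Distinct colors and multiplicities.

length-⊆ : ∀ {xs ys : List ℕ} → Unique xs → xs ⊆ ys → length xs ≤ length ys
length-⊆ [] _ = z≤n
-- Removing `x` from `ys` shortens it strictly, and uniqueness keeps the tail `xs` inside what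
-- remains.
length-⊆ {x ∷ xs} {ys} (x∉xs ∷ xs!) xs⊆ys = ≤-<-trans
  (length-⊆ xs! λ y∈xs → ∈-filter⁺ ≢x? (xs⊆ys (there y∈xs)) (All.lookup x∉xs y∈xs))
  (filter-notAll ≢x? ys (Any.map (λ x≡y x≢y → x≢y x≡y) (xs⊆ys (here refl))))
  where
  ≢x? : Decidable (x ≢_)
  ≢x? = ¬? ∘ (x ≟_)

#distinct : List ℕ → ℕ
#distinct = length ∘ deduplicate _≟_

#distinct-≤ : ∀ xs {ys} → xs ⊆ ys → #distinct xs ≤ length ys
#distinct-≤ xs xs⊆ys = length-⊆ (deduplicate-! _≟_ xs) (xs⊆ys ∘ ∈-deduplicate⁻ _≟_ xs)

#distinct-mono : ∀ xs {ys} → xs ⊆ ys → #distinct xs ≤ #distinct ys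
#distinct-mono xs xs⊆ys = #distinct-≤ xs (∈-deduplicate⁺ _≟_ ∘ xs⊆ys)

#distinct-↭ : ∀ {xs ys} → xs ↭ ys → #distinct xs ≡ #distinct ys
#distinct-↭ {xs} {ys} p =
  ≤-antisym (#distinct-mono xs (∈-resp-↭ p)) (#distinct-mono ys (∈-resp-↭ (↭-sym p)))

#occurrences : ℕ → List ℕ → ℕ
#occurrences c = length ∘ filter (c ≟_)

#occurrences-∷ : ∀ c x xs → #occurrences c xs ≤ #occurrences c (x ∷ xs)
#occurrences-∷ c x xs with does (c ≟ x)
... | true  = n≤1+n _
... | false = ≤-refl

-- The value `nothing` stands for a missing edge, so a rainbow triple also records that the three
-- edges exist.
data Rainbow : Maybe ℕ → Maybe ℕ → Maybe ℕ → Set where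
  rainbow : ∀ {a b c} → a ≢ b → b ≢ c → a ≢ c → Rainbow (just a) (just b) (just c)

rainbow? : ∀ a b c → Dec (Rainbow a b c)
rainbow? (just a) (just b) (just c) =
  map′ (λ (a≢b , b≢c , a≢c) → rainbow a≢b b≢c a≢c) (λ { (rainbow p q r) → p , q , r })
    (¬? (a ≟ b) ×-dec ¬? (b ≟ c) ×-dec ¬? (a ≟ c))
rainbow? nothing  _        _       = no λ ()
rainbow? (just _) nothing  _       = no λ ()
rainbow? (just _) (just _) nothing = no λ ()

-- Rainbow-free colorings and private vertices.

module RainbowFree
  {V : Set} (edge : V → V → Maybe ℕ)
  (edge-sym    : ∀ u v → edge u v ≡ edge v u)
  (edge-irrefl : ∀ v → edge v v ≡ nothing)
  (free        : ∀ u v w → ¬ Rainbow (edge u v) (edge v w) (edge u w))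
  where

  -- Vertex sets are lists.  A vertex listed twice acts as two non-adjacent
  -- twins, so repetitions need not be excluded.

  colors : List V → V → List ℕ
  colors L v = mapMaybe (edge v) L

  deg d^c : List V → V → ℕ
  deg L v = length (colors L v)
  d^c L v = #distinct (colors L v)

  -- If `u` is in `L`, symmetry of `edge` puts the color of an edge `uw` into `colors L w` at least
  -- once, so `≤ 1` then means exactly once. A missing edge makes `Any` empty.
  Private : List V → V → Pred V 0ℓ
  Private L u w = MaybeAny.Any (λ c → #occurrences c (colors L w) ≤ 1) (edge u w)

  private? : ∀ L u → Decidable (Private L u)
  private? L u w = MaybeAny.dec (λ _ → _ ≤? 1) (edge u w)

  privates : List V → V → List V
  privates L u = filter (private? L u) L

  ∈-privates⁻ : ∀ L u {w} → w ∈ privates L u → w ∈ L × Private L u w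
  ∈-privates⁻ L u = ∈-filter⁻ (private? L u) {xs = L}

  #privateColors : List V → V → ℕ
  #privateColors L u = #distinct (mapMaybe (edge u) (privates L u))

  private-color : ∀ L {u w} → Private L u w →
                  ∃[ c ] (edge u w ≡ just c × #occurrences c (colors L w) ≤ 1)
  private-color L {u} {w} p with edge u w | p
  ... | just c | just occ≤1 = c , refl , occ≤1

  occurs-once : ∀ {c} w L {x y} → #occurrences c (colors L w) ≤ 1 →
                x ∈ L → edge w x ≡ just c → y ∈ L → edge w y ≡ just c → x ≡ y
  occurs-once w (z ∷ L) occ (here refl) ex (here refl) ey = refl
  -- The head already uses up the one allowed occurrence of `c`, which leaves none for the tail.
  occurs-once {c} w (z ∷ L) occ (here refl) ex (there y∈) ey
    rewrite ex | filter-accept (c ≟_) {xs = colors L w} refl =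
    contradiction (filter-some (c ≟_) (∈-mapMaybe⁺ (edge w) y∈ ey)) (≤⇒≯ (s≤s⁻¹ occ))
  occurs-once {c} w (z ∷ L) occ (there x∈) ex (here refl) ey
    rewrite ey | filter-accept (c ≟_) {xs = colors L w} refl =
    contradiction (filter-some (c ≟_) (∈-mapMaybe⁺ (edge w) x∈ ex)) (≤⇒≯ (s≤s⁻¹ occ))
  occurs-once {c} w (z ∷ L) occ (there x∈) ex (there y∈) ey with edge w z
  ... | nothing = occurs-once w L occ x∈ ex y∈ ey
  ... | just b  = occurs-once w L (≤-trans (#occurrences-∷ c b (colors L w)) occ) x∈ ex y∈ ey

  -- Suppose `uw` had color `c`. At `u` the color `a` is seen only towards `v`, so `c` differs from
  -- `a`; at `w` the color `b` is seen only towards `v`, so `c` differs from `b`. Then `v`, `u`, `w`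
  -- would span a rainbow triangle.
  privates-independent : ∀ {L v u w a b} → v ∈ L → u ∈ privates L v → w ∈ privates L v →
    edge v u ≡ just a → edge v w ≡ just b → a ≢ b → edge u w ≡ nothing
  privates-independent {L} {v} {u} {w} {a} {b} v∈L u∈ w∈ vu vw a≢b with edge u w in uw
  ... | nothing = refl
  ... | just c  = contradiction
    (subst₂ (λ x y → Rainbow x y (edge v w)) (sym vu) (sym uw)
      (subst (Rainbow _ _) (sym vw) (rainbow a≢c c≢b a≢b)))
    (free v u w)
    where
    seen-once : ∀ {x y z d e} → x ∈ L → y ∈ privates L x → z ∈ L → edge x y ≡ just d →
                edge y z ≡ just e → d ≡ e → x ≡ z
    seen-once {x} {y} x∈L y∈ z∈L xy yz refl
      with d , xy′ , occ ← private-color L (proj₂ (∈-privates⁻ L x y∈))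
      with refl ← just-injective (trans (sym xy) xy′) =
      occurs-once y L occ x∈L (trans (edge-sym y x) xy) z∈L yz
    loop : ∀ {x y d} → edge x y ≡ just d → x ≢ y
    loop xy refl with () ← trans (sym xy) (edge-irrefl _)
    a≢c : a ≢ c
    -- Equal colors would identify `v` with `w`, although `vw` is an edge.
    a≢c a≡c = loop vw (seen-once v∈L u∈ (proj₁ (∈-privates⁻ L v w∈)) vu uw a≡c)
    c≢b : c ≢ b
    c≢b c≡b = loop vu (seen-once v∈L w∈ (proj₁ (∈-privates⁻ L v u∈)) vw
                        (trans (edge-sym w u) uw) (sym c≡b))

  -- Every color at `u` lies in `T`, the private colors listed once each, or in `R`, which has one
  -- entry per non-private edge. Private and non-private edges together number at most `deg L u`.
  d^c+privates≤deg+#privateColors : ∀ L u →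
    d^c L u + length (privates L u) ≤ deg L u + #privateColors L u
  d^c+privates≤deg+#privateColors L u = begin
    d^c L u + s                   ≤⟨ +-monoˡ-≤ s (#distinct-≤ (colors L u) split) ⟩
    length (T ++ R) + s           ≡⟨ cong (_+ s) (length-++ T) ⟩
    length T + length R + s       ≡⟨ solve (length T) (length R) s ⟩
    s + length R + length T
      ≤⟨ +-monoˡ-≤ (length T) (length-mapMaybe-filter (private? L u) (edge u) adjacent L) ⟩
    deg L u + #privateColors L u  ∎
    where
    open ≤-Reasoning
    solve : ∀ a b c → a + b + c ≡ c + b + a
    solve = solve-∀
    s = length (privates L u)
    T = deduplicate _≟_ (mapMaybe (edge u) (privates L u))
    R = mapMaybe (edge u) (filter (¬? ∘ private? L u) L)
    adjacent : ∀ {w} → Private L u w → edge u w ≢ nothing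
    adjacent p uw with _ , uw′ , _ ← private-color L p with () ← trans (sym uw) uw′
    split : colors L u ⊆ T ++ R
    split c∈ with w , w∈ , uw ← ∈-mapMaybe⁻ (edge u) L c∈ with private? L u w
    ... | yes p = ∈-++⁺ˡ (∈-deduplicate⁺ _≟_ (∈-mapMaybe⁺ (edge u) (∈-filter⁺ (private? L u) w∈ p) uw))
    ... | no ¬p = ∈-++⁺ʳ T (∈-mapMaybe⁺ (edge u) (∈-filter⁺ (¬? ∘ private? L u) w∈ ¬p) uw)

  -- Each private color of `v` appears on an edge from `v` to some non-neighbor of `u`: to `u`
  -- itself for the color of `vu`, and to a private vertex of that color otherwise. Hence there are
  -- at most as many private colors as non-neighbors.
  deg+#privateColors≤length : ∀ {L v u} → v ∈ L → u ∈ privates L v →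
                              deg L u + #privateColors L v ≤ length L
  deg+#privateColors≤length {L} {v} {u} v∈L u∈ = ≤-trans
    (+-monoʳ-≤ (deg L u) (≤-trans (#distinct-≤ _ nonadjacent) (length-mapMaybe (edge v) N)))
    (length-mapMaybe-nothing (edge u) L)
    where
    N = filter (is-nothing? (edge u)) L
    u∈L×p = ∈-privates⁻ L v u∈
    nonadjacent : mapMaybe (edge v) (privates L v) ⊆ mapMaybe (edge v) N
    nonadjacent {c} c∈
      with w , w∈ , vw ← ∈-mapMaybe⁻ (edge v) (privates L v) c∈
      with a , vu , _ ← private-color L (proj₂ u∈L×p)
      with a ≟ c
    ... | yes refl = ∈-mapMaybe⁺ (edge v)
      (∈-filter⁺ (is-nothing? (edge u)) (proj₁ u∈L×p) (edge-irrefl u)) vu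
    ... | no a≢c = ∈-mapMaybe⁺ (edge v)
      (∈-filter⁺ (is-nothing? (edge u)) (proj₁ (∈-privates⁻ L v w∈))
        (privates-independent v∈L u∈ w∈ vu vw a≢c)) vw

  -- Finding a vertex of small loss.

  Small : List V → V → Set
  Small L u = d^c L u + length (privates L u) ≤ length L

  -- Matching on `S` decides whether `v` has a private vertex. If not, `v` has no private colors and
  -- is small itself; otherwise the head of the list is small, by maximality of `v`.
  small-near-maximizer : ∀ {L v} → v ∈ L →
    (∀ {u} → u ∈ L → #privateColors L u ≤ #privateColors L v) →
    ∀ S → privates L v ≡ S → ∃[ u ] (u ∈ L × Small L u)
  small-near-maximizer {L} {v} v∈L max [] eq = v , v∈L , (begin
    d^c L v + length (privates L v)    ≤⟨ d^c+privates≤deg+#privateColors L v ⟩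
    deg L v + #privateColors L v       ≡⟨ cong (λ S → deg L v + #distinct (mapMaybe (edge v) S)) eq ⟩
    deg L v + 0                        ≡⟨ +-identityʳ _ ⟩
    deg L v                            ≤⟨ length-mapMaybe (edge v) L ⟩
    length L                           ∎)
    where open ≤-Reasoning
  small-near-maximizer {L} {v} v∈L max (u ∷ _) eq = u , u∈L , (begin
    d^c L u + length (privates L u)    ≤⟨ d^c+privates≤deg+#privateColors L u ⟩
    deg L u + #privateColors L u       ≤⟨ +-monoʳ-≤ (deg L u) (max u∈L) ⟩
    deg L u + #privateColors L v       ≤⟨ deg+#privateColors≤length v∈L u∈ ⟩
    length L                           ∎)
    where
    open ≤-Reasoning
    u∈ : u ∈ privates L v
    u∈ = subst (u ∈_) (sym eq) (here refl)
    u∈L : u ∈ L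
    u∈L = proj₁ (∈-privates⁻ L v u∈)

  ∃-small : ∀ x xs → ∃[ u ] (u ∈ x ∷ xs × Small (x ∷ xs) u)
  ∃-small x xs =
    let v , v∈L , max = maximizer (#privateColors (x ∷ xs)) x xs
    in small-near-maximizer v∈L max _ refl

  -- Loss caused by deleting a vertex.

  d^c-↭ : ∀ {L K} → L ↭ K → ∀ v → d^c L v ≡ d^c K v
  d^c-↭ p v = #distinct-↭ (mapMaybe-↭ (edge v) p)

  Private-↭ : ∀ {L K} → L ↭ K → ∀ {u w} → Private L u w → Private K u w
  Private-↭ p {w = w} =
    MaybeAny.map λ {c} → subst (_≤ 1) (↭-length (filter-↭ (c ≟_) (mapMaybe-↭ (edge w) p)))

  #privates-↭ : ∀ {L K} → L ↭ K → ∀ u → length (privates L u) ≡ length (privates K u)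
  #privates-↭ {L} {K} p u = trans
    (↭-length (filter-↭ (private? L u) p))
    (cong length (filter-≐ (private? L u) (private? K u) (Private-↭ p , Private-↭ (↭-sym p)) K))

  ∑d^c : List V → ℕ
  ∑d^c L = sum (map (d^c L) L)

  ∑d^c-↭ : ∀ {L K} → L ↭ K → ∑d^c L ≡ ∑d^c K
  ∑d^c-↭ {L} p = trans (cong sum (map-cong (d^c-↭ p) L)) (sum-↭ (map⁺ _ p))

  -- Adding `u` brings at most one new color to `w`, and a color that is new at `w` makes `w`
  -- private to `u`. The summation list `ws` is kept apart from `L` so that induction on it leaves
  -- the degrees fixed.
  ∑d^c-insert : ∀ u L ws →
    sum (map (d^c (u ∷ L)) ws) ≤ sum (map (d^c L) ws) + length (filter (private? (u ∷ L) u) ws)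
  ∑d^c-insert u L [] = z≤n
  ∑d^c-insert u L (w ∷ ws) with ih ← ∑d^c-insert u L ws | private? (u ∷ L) u w
  ... | yes _ = begin
      d^c (u ∷ L) w + X      ≤⟨ +-mono-≤ (#distinct-≤ (colors (u ∷ L) w) sub) ih ⟩
      suc (d^c L w) + (Y + k) ≡⟨ solve (d^c L w) Y k ⟩
      d^c L w + Y + suc k    ∎
    where
    open ≤-Reasoning
    X = sum (map (d^c (u ∷ L)) ws)
    Y = sum (map (d^c L) ws)
    k = length (filter (private? (u ∷ L) u) ws)
    solve : ∀ a b c → suc a + (b + c) ≡ a + b + suc c
    solve = solve-∀
    -- The default `0` is only a filler: without an edge `wu` the colors at `w` do not change.
    new = Maybe.fromMaybe 0 (edge w u)
    sub : colors (u ∷ L) w ⊆ new ∷ deduplicate _≟_ (colors L w)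
    sub c∈ with edge w u | c∈
    ... | nothing | c∈L       = there (∈-deduplicate⁺ _≟_ c∈L)
    ... | just _  | here refl = here refl
    ... | just _  | there c∈L = there (∈-deduplicate⁺ _≟_ c∈L)
  ... | no ¬p = ≤-trans
      (+-mono-≤ (#distinct-mono (colors (u ∷ L) w) sub) ih)
      (≤-reflexive (sym (+-assoc (d^c L w) _ _)))
    where
    private-new : ∀ {c} → edge w u ≡ just c → c ∉ colors L w → Private (u ∷ L) u w
    private-new {c} wu c∉ rewrite edge-sym u w | wu = just (≤-reflexive (cong length
      (trans (filter-accept (c ≟_) refl)
        (cong (c ∷_) (filter-none (c ≟_) (All.tabulate λ { x∈ refl → c∉ x∈ }))))))
    sub : colors (u ∷ L) w ⊆ colors L w
    sub c∈ with edge w u in wu | c∈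
    ... | nothing | c∈L       = c∈L
    ... | just _  | there c∈L = c∈L
    ... | just c  | here refl with _∈?_ _≟_ c (colors L w)
    ...   | yes c∈L = c∈L
    ...   | no c∉L  = contradiction (private-new wu c∉L) ¬p

  filter-private-∷ : ∀ u L →
    length (filter (private? (u ∷ L) u) L) ≤ length (privates (u ∷ L) u)
  filter-private-∷ u L with private? (u ∷ L) u u
  ... | yes _ = n≤1+n _
  ... | no _  = ≤-refl

  ∑d^c-delete : ∀ {L u K} → L ↭ u ∷ K → Small L u → ∑d^c L ≤ ∑d^c K + length L
  ∑d^c-delete {L} {u} {K} p small = begin
    ∑d^c L                                ≡⟨ ∑d^c-↭ p ⟩
    d^c (u ∷ K) u + sum (map (d^c (u ∷ K)) K)
      ≤⟨ +-monoʳ-≤ (d^c (u ∷ K) u) (∑d^c-insert u K K) ⟩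
    d^c (u ∷ K) u + (∑d^c K + length (filter (private? (u ∷ K) u) K))
      ≤⟨ +-monoʳ-≤ (d^c (u ∷ K) u) (+-monoʳ-≤ (∑d^c K) (filter-private-∷ u K)) ⟩
    d^c (u ∷ K) u + (∑d^c K + length (privates (u ∷ K) u))
      ≡⟨ rearrange (d^c (u ∷ K) u) (∑d^c K) (length (privates (u ∷ K) u)) ⟩
    ∑d^c K + (d^c (u ∷ K) u + length (privates (u ∷ K) u))
      ≡⟨ cong (∑d^c K +_) (cong₂ _+_ (d^c-↭ p u) (#privates-↭ p u)) ⟨
    ∑d^c K + (d^c L u + length (privates L u))
      ≤⟨ +-monoʳ-≤ (∑d^c K) small ⟩
    ∑d^c K + length L                     ∎
    where
    open ≤-Reasoning
    rearrange : ∀ a b c → a + (b + c) ≡ b + (a + c)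
    rearrange = solve-∀

  -- The strict bound, doubled to avoid division. It fails for the empty list, so the induction
  -- starts at one vertex, where the sum is zero and both sides equal 2. Deleting a small vertex
  -- from `m + 2` vertices costs at most `m + 2`, and twice this is the growth of the right-hand
  -- side.
  ∑d^c-bound : ∀ m L → length L ≡ suc m → suc (∑d^c L) * 2 ≤ suc m * (suc m + 1)
  ∑d^c-bound zero (x ∷ []) refl rewrite edge-irrefl x = ≤-refl
  ∑d^c-bound (suc m) L@(x ∷ xs) len =
    let u , u∈L , small = ∃-small x xs
        K , p = ∈⇒↭∷ u∈L
    in begin
      suc (∑d^c L) * 2                        ≤⟨ *-monoˡ-≤ 2 (s≤s (∑d^c-delete p small)) ⟩
      suc (∑d^c K + length L) * 2             ≡⟨ cong (λ k → suc (∑d^c K + k) * 2) len ⟩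
      suc (∑d^c K + suc (suc m)) * 2          ≡⟨ *-distribʳ-+ 2 (suc (∑d^c K)) (suc (suc m)) ⟩
      suc (∑d^c K) * 2 + suc (suc m) * 2
        ≤⟨ +-monoˡ-≤ _ (∑d^c-bound m K (suc-injective (trans (sym (↭-length p)) len))) ⟩
      suc m * (suc m + 1) + suc (suc m) * 2   ≡⟨ step m ⟩
      suc (suc m) * (suc (suc m) + 1)         ∎
    where
    open ≤-Reasoning
    step : ∀ m → suc m * (suc m + 1) + suc (suc m) * 2 ≡ suc (suc m) * (suc (suc m) + 1)
    step = solve-∀

-- Transfer to edge-colored graphs.

∑≡sum-tabulate : ∀ {n} (f : Fin n → ℕ) → ∑ +-0-commutativeMonoid f ≡ sum (tabulate f)
∑≡sum-tabulate {zero}  f = refl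
∑≡sum-tabulate {suc n} f = cong (f zero +_) (∑≡sum-tabulate (f ∘ suc))

module _ {n : ℕ} (G : EdgeColoredGraph n) where
  open EdgeColoredGraph G using (adj?; color; color-sym; irrefl) renaming (sym to adj-sym)

  -- This has the form used in `incidentColors`, so `d^c (allFin n)` agrees with `colorDegree G` by
  -- computation.
  edge : Fin n → Fin n → Maybe ℕ
  edge u v = Maybe.map color (dec⇒maybe (adj? u v))

  edge-sym : ∀ u v → edge u v ≡ edge v u
  edge-sym u v with adj? u v | adj? v u
  ... | yes p | yes q = cong just (color-sym p q)
  ... | yes p | no ¬q = contradiction (adj-sym p) ¬q
  ... | no ¬p | yes q = contradiction (adj-sym q) ¬p
  ... | no _  | no _  = refl

  edge-irrefl : ∀ v → edge v v ≡ nothing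
  edge-irrefl v with adj? v v
  ... | yes p = contradiction p (irrefl refl)
  ... | no _  = refl

  rainbowTriangle : ∀ {u v w} → Rainbow (edge u v) (edge v w) (edge u w) → RainbowTriangle G u v w
  rainbowTriangle {u} {v} {w} r with adj? u v | adj? v w | adj? u w | r
  ... | yes uv | yes vw | yes uw | rainbow p q r = record
    { uv = uv ; vw = vw ; uw = uw ; uv≢vw = p ; vw≢uw = q ; uv≢uw = r }

theorem2 : (n : ℕ) .{{_ : NonZero n}} (G : EdgeColoredGraph n) →
    colorDegreeSum G ≥ n * (n + 1) / 2 →
    HasRainbowTriangle G
theorem2 n@(suc m) G large
  with any? (λ u → any? λ v → any? λ w → rainbow? (edge G u v) (edge G v w) (edge G u w))
... | yes (u , v , w , r) = u , v , w , rainbowTriangle G r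
... | no none = contradiction large (<⇒≱ (begin-strict
    colorDegreeSum G               ≡⟨ ∑≡sum-tabulate (colorDegree G) ⟩
    sum (tabulate (colorDegree G)) ≡⟨ cong sum (map-tabulate id (colorDegree G)) ⟨
    ∑d^c (allFin n)                <⟨ ≤-refl ⟩
    suc (∑d^c (allFin n))          ≡⟨ m*n/n≡m _ 2 ⟨
    -- The `suc` inside the doubled bound survives halving, which gives the strict inequality.
    suc (∑d^c (allFin n)) * 2 / 2  ≤⟨ /-monoˡ-≤ 2 (∑d^c-bound m (allFin n) (length-tabulate id)) ⟩
    n * (n + 1) / 2                ∎))
  where
  open ≤-Reasoning
  open RainbowFree (edge G) (edge-sym G) (edge-irrefl G)
    (λ u v w r → none (u , v , w , r))
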